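{- Let $K$ be a valued field with value group $\Gamma$ and let $T = \mathrm{Th}(K; +, \cdot, |)$. If $T$ is quasi-VC-minimal, then $\Gamma$ is divisible.
   Context: The valuation is $v:K\to\Gamma\cup\{\infty\}$, and $x\mid y$ is the binary relation on $K$ meaning $v(x)\le v(y)$. $T$ is the complete theory of $K$ in the one-sorted language $\{+,\cdot,|\}$. $\Gamma$ (an ordered abelian group) is divisible if $n\Gamma=\Gamma$ for all $n\ge1$. Directedness: for a set $X$, a family $\mathcal{B}\subseteq\mathcal{P}(X)$ is directed if for all $A,B\in\mathcal{B}$ either $A\subseteq B$, or $B\subseteq A$, or $A\cap B=\emptyset$. For a theory $T$, a set of formulas $\Psi=\{\psi_i(x;\bar y_i) : i\in I\}$ ($x$ a single variable, the parameter variables $\bar y_i$ may vary with $i$) is directed if for all $\mathfrak{M}\models T$ the family $\{\psi_i(\mathfrak{M};\bar a) : i\in I, \bar a\in M^{|\bar y_i|}\}$ is directed, where $\psi_i(\mathfrak{M};\bar a)=\{b\in M : \mathfrak{M}\models\psi_i(b;\bar a)\}$. Quasi-VC-minimality: $T$ is quasi-VC-minimal if there is a directed $\Psi$ such that every formula $\varphi(x)$ in the single variable $x$, with parameters from a model of $T$, is $T$-equivalent to a boolean combination of instances $\psi(x;\bar a)$ of formulas $\psi\in\Psi$ and parameter-free formulas in $x$. -}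

module Defs where

open import Algebra.Bundles using (AbelianGroup; CommutativeRing)
import Algebra.Construct.NaturalChoice.Min as Min
import Algebra.Definitions as AlgDefs
import Algebra.Definitions.RawMonoid as RawMonoidDefs
open import Data.Fin.Base using (Fin)
open import Data.Nat.Base using (ℕ; suc; NonZero)
open import Data.Product.Base using (Σ; ∃-syntax; _×_; _,_; proj₁; proj₂)
open import Data.Sum.Base using (_⊎_; [_,_]′)
open import Data.Vec.Base using (Vec; []; _∷_; lookup)
open import Function.Bundles using (_⇔_)
open import Level using (Level) renaming (suc to lsuc)
open import Relation.Binary.Bundles using (TotalOrder)
open import Relation.Binary.Core using (Rel; _Preserves_⟶_)
open import Relation.Binary.Definitions using (_Respects₂_)
open import Relation.Binary.Structures using (IsEquivalence; IsTotalOrder)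
import Relation.Binary.Construct.Add.Supremum.Equality as SupEquality
import Relation.Binary.Construct.Add.Supremum.NonStrict as SupOrder
open import Relation.Nullary.Construct.Add.Supremum using (_⁺; ⊤⁺; [_])
open import Relation.Nullary.Negation.Core using (¬_)
open import Relation.Unary using (Pred; _⊆_; _⊥_; _≐_; _∩_; _∪_; ∁)

-- All sets (fields, value groups, structures, index sets) live in one
-- arbitrary universe Set ℓ.

record Field (ℓ : Level) : Set (lsuc ℓ) where
  field
    commutativeRing : CommutativeRing ℓ ℓ

  open CommutativeRing commutativeRing public
  open AlgDefs _≈_ using (Invertible)

  field
    1≉0        : ¬ (1# ≈ 0#)
    invertible : ∀ x → ¬ (x ≈ 0#) → Invertible 1# _*_ x

record OrderedAbelianGroup (ℓ : Level) : Set (lsuc ℓ) where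
  infix 4 _≤_

  field
    abelianGroup : AbelianGroup ℓ ℓ

  open AbelianGroup abelianGroup public
    renaming (_∙_ to _+_; ε to 0#; _⁻¹ to -_)

  field
    _≤_          : Rel Carrier ℓ
    isTotalOrder : IsTotalOrder _≈_ _≤_
    +-monoʳ-≤    : ∀ z {x y} → x ≤ y → (z + x) ≤ (z + y)

-- Γ ∪ {∞}, with ⊤⁺ as ∞.
module Extended {ℓ} (Γ : OrderedAbelianGroup ℓ) where
  open OrderedAbelianGroup Γ

  open SupEquality _≈_ public using (_≈⁺_)
  open SupOrder _≤_ public using (_≤⁺_)

  infixl 6 _+⁺_

  _+⁺_ : Carrier ⁺ → Carrier ⁺ → Carrier ⁺
  [ γ ] +⁺ [ δ ] = [ γ + δ ]
  [ γ ] +⁺ ⊤⁺    = ⊤⁺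
  ⊤⁺    +⁺ _     = ⊤⁺

  totalOrder⁺ : TotalOrder ℓ ℓ ℓ
  totalOrder⁺ = record
    { isTotalOrder = SupOrder.≤⁺-isTotalOrder _≤_ isTotalOrder }

  open Min totalOrder⁺ public using (_⊓_)

-- Surjectivity says that Γ is exactly the value group v(K \ {0}).
record Valuation {ℓ} (K : Field ℓ) (Γ : OrderedAbelianGroup ℓ) : Set ℓ where
  private
    module K = Field K
    module Γ = OrderedAbelianGroup Γ
  open Extended Γ

  field
    v          : K.Carrier → Γ.Carrier ⁺
    v-cong     : v Preserves K._≈_ ⟶ _≈⁺_
    v≈∞⇔x≈0    : ∀ x → (v x ≈⁺ ⊤⁺) ⇔ (x K.≈ K.0#)
    v-*        : ∀ x y → v (x K.* y) ≈⁺ v x +⁺ v y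
    v-+        : ∀ x y → (v x ⊓ v y) ≤⁺ v (x K.+ y)
    surjective : ∀ γ → ∃[ x ] v x ≈⁺ [ γ ]

Divisible : ∀ {ℓ} → OrderedAbelianGroup ℓ → Set ℓ
Divisible Γ = ∀ n .{{_ : NonZero n}} γ → ∃[ δ ] (n · δ) ≈ γ
  where
  open OrderedAbelianGroup Γ
  open RawMonoidDefs rawMonoid renaming (_×_ to _·_)

infixl 7 _*′_
infixl 6 _+′_
infix  4 _≈′_ _∣′_
infix  3 ¬′_ ∃′_
infixr 2 _∧′_

-- The language is {+, ·, |}.  Free variables are de Bruijn indices in Fin n;
-- the quantifier binds index zero.
data Term (n : ℕ) : Set where
  var       : Fin n → Term n
  _+′_ _*′_ : Term n → Term n → Term n

-- The remaining connectives and ∀ are definable, the semantics being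
-- used under excluded middle.
data Formula (n : ℕ) : Set where
  _≈′_ _∣′_ : Term n → Term n → Formula n
  ¬′_       : Formula n → Formula n
  _∧′_      : Formula n → Formula n → Formula n
  ∃′_       : Formula (suc n) → Formula n

Sentence : Set
Sentence = Formula 0

Theory : (ℓ : Level) → Set (lsuc ℓ)
Theory ℓ = Pred Sentence ℓ

-- Equality is interpreted by a congruence _≈_, so that the structure meant
-- is the quotient of Carrier by _≈_.
record Structure (ℓ : Level) : Set (lsuc ℓ) where
  infix 4 _≈_ _∣_

  field
    Carrier       : Set ℓ
    _≈_           : Rel Carrier ℓ
    _+_ _*_       : Carrier → Carrier → Carrier
    _∣_           : Rel Carrier ℓ
    isEquivalence : IsEquivalence _≈_
    +-cong        : AlgDefs.Congruent₂ _≈_ _+_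
    *-cong        : AlgDefs.Congruent₂ _≈_ _*_
    ∣-resp-≈      : _∣_ Respects₂ _≈_

module _ {ℓ} (M : Structure ℓ) where
  open Structure M

  eval : ∀ {n} → Term n → Vec Carrier n → Carrier
  eval (var i)  ρ = lookup ρ i
  eval (s +′ t) ρ = eval s ρ + eval t ρ
  eval (s *′ t) ρ = eval s ρ * eval t ρ

  Sat : ∀ {n} → Formula n → Vec Carrier n → Set ℓ
  Sat (s ≈′ t) ρ = eval s ρ ≈ eval t ρ
  Sat (s ∣′ t) ρ = eval s ρ ∣ eval t ρ
  Sat (¬′ φ)   ρ = ¬ Sat φ ρ
  Sat (φ ∧′ ψ) ρ = Sat φ ρ × Sat ψ ρ
  Sat (∃′ φ)   ρ = ∃[ a ] Sat φ (a ∷ ρ)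

  -- φ(M; ā): index zero of φ is x, the others are the parameter variables.
  definedSet : ∀ {m} → Formula (suc m) → Vec Carrier m → Pred Carrier ℓ
  definedSet φ ā b = Sat φ (b ∷ ā)

  Th : Theory ℓ
  Th σ = Sat σ []

_⊨_ : ∀ {ℓ} → Structure ℓ → Theory ℓ → Set ℓ
M ⊨ T = ∀ σ → T σ → Sat M σ []

DirectedFamily : ∀ {ℓ} {X J : Set ℓ} → (J → Pred X ℓ) → Set ℓ
DirectedFamily B = ∀ i j → B i ⊆ B j ⊎ B j ⊆ B i ⊎ B i ⊥ B j

record FormulaSet (ℓ : Level) : Set (lsuc ℓ) where
  field
    Index : Set ℓ
    arity : Index → ℕ
    ψ     : (i : Index) → Formula (suc (arity i))

module _ {ℓ} (Ψ : FormulaSet ℓ) (M : Structure ℓ) where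
  open FormulaSet Ψ
  open Structure M using (Carrier)

  Instance : Set ℓ
  Instance = Σ Index (λ i → Vec Carrier (arity i))

  instanceSet : Instance → Pred Carrier ℓ
  instanceSet (i , ā) = definedSet M (ψ i) ā

Directed : ∀ {ℓ} → Theory ℓ → FormulaSet ℓ → Set (lsuc ℓ)
Directed {ℓ} T Ψ =
  ∀ (M : Structure ℓ) → M ⊨ T → DirectedFamily (instanceSet Ψ M)

data BooleanCombination {a} (A : Set a) : Set a where
  atom  : A → BooleanCombination A
  not   : BooleanCombination A → BooleanCombination A
  _and_ : BooleanCombination A → BooleanCombination A → BooleanCombination A
  _or_  : BooleanCombination A → BooleanCombination A → BooleanCombination A

combine : ∀ {a x ℓ} {A : Set a} {X : Set x} →
          (A → Pred X ℓ) → BooleanCombination A → Pred X ℓ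
combine S (atom a)  = S a
combine S (not β)   = ∁ (combine S β)
combine S (β and γ) = combine S β ∩ combine S γ
combine S (β or γ)  = combine S β ∪ combine S γ

-- For formulas with parameters from M, T-equivalence is equivalence modulo
-- the elementary diagram of M.  That theory is complete, so it amounts to
-- the two formulas defining the same subset of M.
QuasiVCMinimal : ∀ {ℓ} → Theory ℓ → Set (lsuc ℓ)
QuasiVCMinimal {ℓ} T =
  Σ (FormulaSet ℓ) λ Ψ →
    Directed T Ψ ×
    (∀ (M : Structure ℓ) → M ⊨ T →
     ∀ {m} (φ : Formula (suc m)) (c̄ : Vec (Structure.Carrier M) m) →
     Σ (BooleanCombination (Instance Ψ M ⊎ Formula 1)) λ β →
       definedSet M φ c̄ ≐
       combine [ instanceSet Ψ M , (λ θ → definedSet M θ []) ]′ β)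

module _ {ℓ} {K : Field ℓ} {Γ : OrderedAbelianGroup ℓ}
         (V : Valuation K Γ) where
  private
    module K = Field K
  open Valuation V
  open Extended Γ
  open TotalOrder totalOrder⁺ using (≤-resp-≈)

  valuedFieldStructure : Structure ℓ
  valuedFieldStructure = record
    { Carrier       = K.Carrier
    ; _≈_           = K._≈_
    ; _+_           = K._+_
    ; _*_           = K._*_
    ; _∣_           = λ x y → v x ≤⁺ v y
    ; isEquivalence = K.isEquivalence
    ; +-cong        = K.+-cong
    ; *-cong        = K.*-cong
    ; ∣-resp-≈      = (λ x≈y → proj₁ ≤-resp-≈ (v-cong x≈y))
                    , (λ x≈y → proj₂ ≤-resp-≈ (v-cong x≈y))
    }

{-# OPTIONS --safe #-}

-- Call the instances of the directed formulas balls.  Suppose that γ > 0 is not in nΓ, and let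
-- S_a be the set of all x with v(x − a) ∈ nΓ.  The multiples of γ lie inside or outside nΓ as one
-- likes, so K contains finite binary trees of points in which the values v(x − y) follow any
-- prescribed in/out pattern along the branches.  By a Ramsey argument the finitely many
-- parameter-free formulas in use are constant on a suitable subtree.  Finitely many balls are convex for
-- a common linear preorder, because they are directed.  Repeatedly taking the least point and
-- passing to the half of the tree not containing it gives x₀ ≤ x₁ ≤ … and a last point a such that
-- membership of x₀, x₁, … in S_a alternates; a combination of k balls changes at most 2k times
-- along this sequence.  So no bound on the combinations serves all sets S_a in K, and by
-- compactness some S_a in a model of Th(K) is not a combination at all.
module Submission where

open import Defs
open import Algebra.Bundles using (CommutativeRing; Ring)
import Algebra.Construct.NaturalChoice.Min as Min
import Algebra.Properties.CommutativeMonoid.Mult as Mult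
open import Algebra.Properties.CommutativeSemigroup using (interchange)
import Algebra.Properties.Group as GroupProperties
import Algebra.Properties.Ring as RingProperties
open import Axiom.ExcludedMiddle using (ExcludedMiddle)
open import Data.Bool.Base as Bool using (Bool; true; false; _∧_; _∨_; if_then_else_)
import Data.Bool.Properties as Bool
open import Data.Empty using (⊥-elim)
open import Data.Fin.Base using (zero; suc)
open import Data.List.Base
  using (List; []; _∷_; _++_; map; concatMap; cartesianProductWith; allFin; upTo; length)
open import Data.List.Extrema using (argmin; argmin-all; f[argmin]≤f[xs])
open import Data.List.Membership.Propositional using (_∈_; find; lose)
open import Data.List.Membership.Propositional.Properties
  using (∈-++⁺ˡ; ∈-++⁺ʳ; ∈-++⁻; ∈-map⁺; ∈-cartesianProductWith⁺; ∈-concatMap⁺; ∈-allFin; ∈-upTo⁺)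
open import Data.List.Properties using (length-++; length-map; map-cong; map-++)
import Data.List.Relation.Binary.Lex.NonStrict as Lex
open import Data.List.Relation.Binary.Pointwise using (Pointwise; []; _∷_)
open import Data.List.Relation.Binary.Subset.Propositional using () renaming (_⊆_ to _⊆ᴸ_)
open import Data.List.Relation.Unary.All as All using (All; []; _∷_)
import Data.List.Relation.Unary.All.Properties as All
open import Data.List.Relation.Unary.AllPairs using (AllPairs; []; _∷_)
open import Data.List.Relation.Unary.Any as Any using (here; there; any?)
open import Data.Nat.Base as ℕ using (ℕ; zero; suc; z≤n; s≤s)
import Data.Nat.Properties as ℕ
open import Data.Product.Base using (Σ; ∃; ∃-syntax; _×_; _,_; proj₁; proj₂)
open import Data.Sum.Base as Sum using (_⊎_; inj₁; inj₂; [_,_]′)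
open import Data.Unit.Polymorphic.Base using (⊤; tt)
open import Data.Vec.Base using (Vec; []; _∷_; lookup)
open import Function.Base using (id; _∘_; case_of_)
open import Function.Bundles using (_⇔_; mk⇔; module Equivalence)
open import Level using (Level)
open import Relation.Binary.Bundles using (TotalOrder; DecTotalOrder)
import Relation.Binary.Construct.Add.Supremum.Equality as SupEquality
import Relation.Binary.Construct.Add.Supremum.NonStrict as SupOrder
open import Relation.Binary.PropositionalEquality
  using (_≡_; refl; sym; trans; cong; cong₂; subst; subst₂)
import Relation.Binary.Reasoning.Setoid as SetoidReasoning
open import Relation.Binary.Structures using (IsEquivalence; IsTotalOrder)
open import Relation.Nullary.Construct.Add.Supremum using (_⁺; ⊤⁺; [_])
open import Relation.Nullary.Decidable
  using (yes; no; does; dec-true; does-≡; does-⇔; decidable-stable; ¬?; _×-dec_; _⊎-dec_)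
open import Relation.Nullary.Negation.Core using (¬_)
open import Relation.Unary using (Pred; _⊆_; _⊥_; _≐_; _∩_; _∪_; ∁)

open Equivalence using (to; from)

-- Boolean combinations under a map of their atoms.

module _ {a} {A : Set a} {b} {B : Set b} where

  mapBC : (A → B) → BooleanCombination A → BooleanCombination B
  mapBC f (atom x)  = atom (f x)
  mapBC f (not β)   = not (mapBC f β)
  mapBC f (β and γ) = mapBC f β and mapBC f γ
  mapBC f (β or γ)  = mapBC f β or mapBC f γ

  combine-mapBC : ∀ {x ℓ} {X : Set x} {S : A → Pred X ℓ} {S′ : B → Pred X ℓ} (f : A → B) →
                  (∀ a {x} → S a x ⇔ S′ (f a) x) →
                  ∀ β {x} → combine S β x ⇔ combine S′ (mapBC f β) x
  combine-mapBC f S⇔S′ (atom a) = S⇔S′ a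
  combine-mapBC f S⇔S′ (not β) = mk⇔ (λ ¬s s′ → ¬s (from eq s′)) (λ ¬s′ s → ¬s′ (to eq s))
    where eq = combine-mapBC f S⇔S′ β
  combine-mapBC f S⇔S′ (β and γ) =
    mk⇔ (λ (p , q) → to eqβ p , to eqγ q) (λ (p , q) → from eqβ p , from eqγ q)
    where eqβ = combine-mapBC f S⇔S′ β
          eqγ = combine-mapBC f S⇔S′ γ
  combine-mapBC f S⇔S′ (β or γ) =
    mk⇔ [ inj₁ ∘ to eqβ , inj₂ ∘ to eqγ ]′ [ inj₁ ∘ from eqβ , inj₂ ∘ from eqγ ]′
    where eqβ = combine-mapBC f S⇔S′ β
          eqγ = combine-mapBC f S⇔S′ γ

-- Exhausting terms, formulas and Skolem functions by finite lists.

Eventually : ∀ {p} → Pred ℕ p → Set p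
Eventually P = ∃[ k ] ∀ {m} → k ℕ.≤ m → P m

module _ {p q} {P : Pred ℕ p} {Q : Pred ℕ q} where

  -- Because membership persists at all later stages, subexpressions found at different stages are
  -- both present at a common one.
  eventually-∩ : Eventually P → Eventually Q → Eventually (P ∩ Q)
  eventually-∩ (k , p) (l , q) =
    k ℕ.⊔ l , λ k⊔l≤m → p (ℕ.≤-trans (ℕ.m≤m⊔n k l) k⊔l≤m) , q (ℕ.≤-trans (ℕ.m≤n⊔m k l) k⊔l≤m)

  eventually-⊆ : P ⊆ Q → Eventually P → Eventually Q
  eventually-⊆ P⊆Q (k , p) = k , λ k≤m → P⊆Q (p k≤m)

  eventually-suc : Eventually P → (∀ {k} → P k → Q (suc k)) → Eventually Q
  eventually-suc (k , p) f = suc k , λ { (s≤s k≤m) → f (p k≤m) }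

eventually-> : ∀ n → Eventually (n ℕ.<_)
eventually-> n = suc n , id

terms : ∀ n → ℕ → List (Term n)
terms n zero    = []
terms n (suc k) = map var (allFin n)
               ++ cartesianProductWith _+′_ (terms n k) (terms n k)
               ++ cartesianProductWith _*′_ (terms n k) (terms n k)

formulas : ∀ n → ℕ → List (Formula n)
formulas n zero    = []
formulas n (suc k) = cartesianProductWith _≈′_ (terms n k) (terms n k)
                  ++ cartesianProductWith _∣′_ (terms n k) (terms n k)
                  ++ map ¬′_ (formulas n k)
                  ++ cartesianProductWith _∧′_ (formulas n k) (formulas n k)
                  ++ map ∃′_ (formulas (suc n) k)

terms-exhaustive : ∀ {n} (t : Term n) → Eventually (λ k → t ∈ terms n k)
terms-exhaustive (var i) = eventually-suc (0 , λ _ → ∈-allFin i) (∈-++⁺ˡ ∘ ∈-map⁺ var)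
terms-exhaustive {n} (s +′ t) =
  eventually-suc (eventually-∩ (terms-exhaustive s) (terms-exhaustive t))
    (λ (s∈ , t∈) → ∈-++⁺ʳ (map var (allFin n)) (∈-++⁺ˡ (∈-cartesianProductWith⁺ _+′_ s∈ t∈)))
terms-exhaustive {n} (s *′ t) =
  eventually-suc (eventually-∩ (terms-exhaustive s) (terms-exhaustive t))
    (λ {k} (s∈ , t∈) → ∈-++⁺ʳ (map var (allFin n))
      (∈-++⁺ʳ (cartesianProductWith _+′_ (terms n k) (terms n k))
        (∈-cartesianProductWith⁺ _*′_ s∈ t∈)))

formulas-exhaustive : ∀ {n} (φ : Formula n) → Eventually (λ k → φ ∈ formulas n k)
formulas-exhaustive (s ≈′ t) =
  eventually-suc (eventually-∩ (terms-exhaustive s) (terms-exhaustive t))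
    (λ (s∈ , t∈) → ∈-++⁺ˡ (∈-cartesianProductWith⁺ _≈′_ s∈ t∈))
formulas-exhaustive {n} (s ∣′ t) =
  eventually-suc (eventually-∩ (terms-exhaustive s) (terms-exhaustive t))
    (λ {k} (s∈ , t∈) → ∈-++⁺ʳ (cartesianProductWith _≈′_ (terms n k) (terms n k))
      (∈-++⁺ˡ (∈-cartesianProductWith⁺ _∣′_ s∈ t∈)))
formulas-exhaustive {n} (¬′ φ) =
  eventually-suc (formulas-exhaustive φ)
    (λ {k} φ∈ → ∈-++⁺ʳ (cartesianProductWith _≈′_ (terms n k) (terms n k))
      (∈-++⁺ʳ (cartesianProductWith _∣′_ (terms n k) (terms n k))
        (∈-++⁺ˡ (∈-map⁺ ¬′_ φ∈))))
formulas-exhaustive {n} (φ ∧′ ψ) =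
  eventually-suc (eventually-∩ (formulas-exhaustive φ) (formulas-exhaustive ψ))
    (λ {k} (φ∈ , ψ∈) → ∈-++⁺ʳ (cartesianProductWith _≈′_ (terms n k) (terms n k))
      (∈-++⁺ʳ (cartesianProductWith _∣′_ (terms n k) (terms n k))
        (∈-++⁺ʳ (map ¬′_ (formulas n k))
          (∈-++⁺ˡ (∈-cartesianProductWith⁺ _∧′_ φ∈ ψ∈)))))
formulas-exhaustive {n} (∃′ φ) =
  eventually-suc (formulas-exhaustive φ)
    (λ {k} φ∈ → ∈-++⁺ʳ (cartesianProductWith _≈′_ (terms n k) (terms n k))
      (∈-++⁺ʳ (cartesianProductWith _∣′_ (terms n k) (terms n k))
        (∈-++⁺ʳ (map ¬′_ (formulas n k))
          (∈-++⁺ʳ (cartesianProductWith _∧′_ (formulas n k) (formulas n k))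
            (∈-map⁺ ∃′_ φ∈)))))

vecs : ∀ {a} {A : Set a} n → List A → List (Vec A n)
vecs zero    xs = [] ∷ []
vecs (suc n) xs = cartesianProductWith _∷_ xs (vecs n xs)

WithParameters : ∀ {a} → (ℕ → Set) → Set a → Set a
WithParameters F A = Σ ℕ λ n → F n × Vec A n

module _ {F : ℕ → Set} (e : ∀ n → ℕ → List (F n)) {a} {A : Set a} where

  withParameters : ℕ → List A → List (WithParameters F A)
  withParameters k xs =
    concatMap (λ n → cartesianProductWith (λ φ ρ → n , φ , ρ) (e n k) (vecs n xs)) (upTo k)

  ∈-withParameters⁺ : ∀ {k xs n φ} {ρ : Vec A n} →
                      n ℕ.< k → φ ∈ e n k → ρ ∈ vecs n xs → (n , φ , ρ) ∈ withParameters k xs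
  ∈-withParameters⁺ n<k φ∈ ρ∈ =
    ∈-concatMap⁺ _ (Any.map (λ { refl → ∈-cartesianProductWith⁺ _ φ∈ ρ∈ }) (∈-upTo⁺ n<k))

Literal : ∀ {a} → Set a → Set a
Literal = WithParameters (Formula ∘ suc)

-- wit β stands for an element satisfying β, or for generic at those indices where β has no solution.
data Skolem {ℓ : Level} : Set ℓ where
  generic : Skolem
  add mul : Skolem {ℓ} → Skolem {ℓ} → Skolem
  wit     : BooleanCombination (Literal (Skolem {ℓ})) → Skolem

module _ {ℓ : Level} where

  mutual
    skolems : ℕ → List (Skolem {ℓ})
    skolems zero    = []
    skolems (suc k) = (generic ∷ [])
                   ++ cartesianProductWith add (skolems k) (skolems k)
                   ++ cartesianProductWith mul (skolems k) (skolems k)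
                   ++ map wit (combinations k)

    combinations : ℕ → List (BooleanCombination (Literal (Skolem {ℓ})))
    combinations zero    = []
    combinations (suc k) = map atom (withParameters (formulas ∘ suc) k (skolems k))
                        ++ map not (combinations k)
                        ++ cartesianProductWith _and_ (combinations k) (combinations k)
                        ++ cartesianProductWith _or_ (combinations k) (combinations k)

  mutual
    skolems-exhaustive : ∀ t → Eventually (λ k → t ∈ skolems k)
    skolems-exhaustive generic = 1 , λ { (s≤s _) → here refl }
    skolems-exhaustive (add s t) =
      eventually-suc (eventually-∩ (skolems-exhaustive s) (skolems-exhaustive t))
        (λ (s∈ , t∈) → there (∈-++⁺ˡ (∈-cartesianProductWith⁺ add s∈ t∈)))
    skolems-exhaustive (mul s t) =
      eventually-suc (eventually-∩ (skolems-exhaustive s) (skolems-exhaustive t))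
        (λ {k} (s∈ , t∈) → there (∈-++⁺ʳ (cartesianProductWith add (skolems k) (skolems k))
          (∈-++⁺ˡ (∈-cartesianProductWith⁺ mul s∈ t∈))))
    skolems-exhaustive (wit β) =
      eventually-suc (combinations-exhaustive β)
        (λ {k} β∈ → there (∈-++⁺ʳ (cartesianProductWith add (skolems k) (skolems k))
          (∈-++⁺ʳ (cartesianProductWith mul (skolems k) (skolems k)) (∈-map⁺ wit β∈))))

    combinations-exhaustive : ∀ β → Eventually (λ k → β ∈ combinations k)
    combinations-exhaustive (atom (n , φ , ts)) =
      eventually-suc
        (eventually-∩ (eventually-> n)
          (eventually-∩ (formulas-exhaustive φ) (vecs-exhaustive ts)))
        (λ (n<k , φ∈ , ts∈) → ∈-++⁺ˡ (∈-map⁺ atom (∈-withParameters⁺ (formulas ∘ suc) n<k φ∈ ts∈)))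
    combinations-exhaustive (not β) =
      eventually-suc (combinations-exhaustive β)
        (λ {k} β∈ → ∈-++⁺ʳ (map atom (withParameters (formulas ∘ suc) k (skolems k)))
          (∈-++⁺ˡ (∈-map⁺ not β∈)))
    combinations-exhaustive (β and γ) =
      eventually-suc (eventually-∩ (combinations-exhaustive β) (combinations-exhaustive γ))
        (λ {k} (β∈ , γ∈) → ∈-++⁺ʳ (map atom (withParameters (formulas ∘ suc) k (skolems k)))
          (∈-++⁺ʳ (map not (combinations k))
            (∈-++⁺ˡ (∈-cartesianProductWith⁺ _and_ β∈ γ∈))))
    combinations-exhaustive (β or γ) =
      eventually-suc (eventually-∩ (combinations-exhaustive β) (combinations-exhaustive γ))
        (λ {k} (β∈ , γ∈) → ∈-++⁺ʳ (map atom (withParameters (formulas ∘ suc) k (skolems k)))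
          (∈-++⁺ʳ (map not (combinations k))
            (∈-++⁺ʳ (cartesianProductWith _and_ (combinations k) (combinations k))
              (∈-cartesianProductWith⁺ _or_ β∈ γ∈))))

    vecs-exhaustive : ∀ {n} (ts : Vec (Skolem {ℓ}) n) → Eventually (λ k → ts ∈ vecs n (skolems k))
    vecs-exhaustive []       = 0 , λ _ → here refl
    vecs-exhaustive (t ∷ ts) with eventually-∩ (skolems-exhaustive t) (vecs-exhaustive ts)
    ... | k , t∈ = k , λ k≤m → ∈-cartesianProductWith⁺ _∷_ (proj₁ (t∈ k≤m)) (proj₂ (t∈ k≤m))

-- An ultrafilter for countably many conditions.

-- Conditions are decided one after the other, each time keeping an infinite set of indices.
module Refinement (em : ∀ {a} → ExcludedMiddle a) {ℓ} {C : Set ℓ}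
                  (⟦_⟧ : C → Pred ℕ ℓ) (conditions : ℕ → List C)
                  (exhaustive : ∀ c → Eventually (λ k → c ∈ conditions k)) where

  Infinite : Pred ℕ ℓ → Set ℓ
  Infinite A = ∀ k → ∃[ i ] k ℕ.≤ i × A i

  decide : Pred ℕ ℓ → C → Pred ℕ ℓ
  decide A c with em {P = Infinite (A ∩ ⟦ c ⟧)}
  ... | yes _ = A ∩ ⟦ c ⟧
  ... | no  _ = A ∩ ∁ ⟦ c ⟧

  decideAll : Pred ℕ ℓ → List C → Pred ℕ ℓ
  decideAll A []       = A
  decideAll A (c ∷ cs) = decideAll (decide A c) cs

  decide-⊆ : ∀ A c → decide A c ⊆ A
  decide-⊆ A c with em {P = Infinite (A ∩ ⟦ c ⟧)}
  ... | yes _ = proj₁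
  ... | no  _ = proj₁

  decide-decides : ∀ A c → decide A c ⊆ ⟦ c ⟧ ⊎ decide A c ⊆ ∁ ⟦ c ⟧
  decide-decides A c with em {P = Infinite (A ∩ ⟦ c ⟧)}
  ... | yes _ = inj₁ proj₂
  ... | no  _ = inj₂ proj₂

  -- If `A ∩ ⟦ c ⟧` is not infinite, it is bounded by some `k`, and every element of `A` from `k` on
  -- lies in `A ∩ ∁ ⟦ c ⟧`.
  decide-infinite : ∀ A c → Infinite A → Infinite (decide A c)
  decide-infinite A c ∞A with em {P = Infinite (A ∩ ⟦ c ⟧)}
  ... | yes ∞Ac = ∞Ac
  ... | no ¬∞Ac with em {P = ∃[ k ] ∀ i → k ℕ.≤ i → ¬ (A ∩ ⟦ c ⟧) i}
  ...   | no ¬bound = ⊥-elim (¬∞Ac λ k → case em of λ where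
            (yes p) → p
            (no ¬p) → ⊥-elim (¬bound (k , λ i k≤i p → ¬p (i , k≤i , p))))
  ...   | yes (k , bound) = λ l → case ∞A (k ℕ.⊔ l) of λ where
            (i , k⊔l≤i , Ai) → i , ℕ.≤-trans (ℕ.m≤n⊔m k l) k⊔l≤i
                             , Ai , λ ci → bound i (ℕ.≤-trans (ℕ.m≤m⊔n k l) k⊔l≤i) (Ai , ci)

  decideAll-⊆ : ∀ A cs → decideAll A cs ⊆ A
  decideAll-⊆ A []       = id
  decideAll-⊆ A (c ∷ cs) = decide-⊆ A c ∘ decideAll-⊆ (decide A c) cs

  decideAll-decides : ∀ A {cs c} → c ∈ cs → decideAll A cs ⊆ ⟦ c ⟧ ⊎ decideAll A cs ⊆ ∁ ⟦ c ⟧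
  decideAll-decides A {c ∷ cs} (here refl) with decide-decides A c
  ... | inj₁ in-c = inj₁ (in-c ∘ decideAll-⊆ (decide A c) cs)
  ... | inj₂ in-∁c = inj₂ (in-∁c ∘ decideAll-⊆ (decide A c) cs)
  decideAll-decides A {d ∷ cs} (there c∈) = decideAll-decides (decide A d) c∈

  decideAll-infinite : ∀ A cs → Infinite A → Infinite (decideAll A cs)
  decideAll-infinite A []       ∞A = ∞A
  decideAll-infinite A (c ∷ cs) ∞A = decideAll-infinite (decide A c) cs (decide-infinite A c ∞A)

  basic : ℕ → Pred ℕ ℓ
  basic zero    = λ _ → ⊤
  basic (suc k) = decideAll (basic k) (conditions k)

  basic-infinite : ∀ k → Infinite (basic k)
  basic-infinite zero    l = l , ℕ.≤-refl , tt
  basic-infinite (suc k) = decideAll-infinite (basic k) (conditions k) (basic-infinite k)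

  basic-antitone : ∀ {k l} → k ℕ.≤ l → basic l ⊆ basic k
  basic-antitone k≤l = go (ℕ.≤⇒≤′ k≤l)
    where
    go : ∀ {k l} → k ℕ.≤′ l → basic l ⊆ basic k
    go (ℕ.≤′-reflexive refl)     = id
    go {l = suc l} (ℕ.≤′-step p) = go p ∘ decideAll-⊆ (basic l) (conditions l)

  -- The filter generated by the decreasing sets `basic k`. On the sets `⟦ c ⟧` it behaves like a
  -- nonprincipal ultrafilter, by `large-decided` and `large-infinite`.
  Large : Pred ℕ ℓ → Set ℓ
  Large P = ∃[ k ] basic k ⊆ P

  large-⊆ : ∀ {P Q} → P ⊆ Q → Large P → Large Q
  large-⊆ P⊆Q (k , k⊆P) = k , P⊆Q ∘ k⊆P

  large-∩ : ∀ {P Q} → Large P → Large Q → Large (P ∩ Q)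
  large-∩ (k , k⊆P) (l , l⊆Q) =
    k ℕ.⊔ l , λ i∈ → k⊆P (basic-antitone (ℕ.m≤m⊔n k l) i∈) , l⊆Q (basic-antitone (ℕ.m≤n⊔m k l) i∈)

  large-infinite : ∀ {P} → Large P → Infinite P
  large-infinite (k , k⊆P) l = case basic-infinite k l of λ where
    (i , l≤i , i∈) → i , l≤i , k⊆P i∈

  large-disjoint : ∀ {P} → Large P → ¬ Large (∁ P)
  large-disjoint P ¬P = case large-infinite (large-∩ P ¬P) 0 of λ where
    (_ , _ , p , ¬p) → ¬p p

  large-decided : ∀ c → Large ⟦ c ⟧ ⊎ Large (∁ ⟦ c ⟧)
  large-decided c with exhaustive c
  ... | k , c∈ with decideAll-decides (basic k) (c∈ ℕ.≤-refl)
  ...   | inj₁ in-c = inj₁ (suc k , in-c)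
  ...   | inj₂ in-∁c = inj₂ (suc k , in-∁c)

-- The Skolem ultrapower and Łoś's theorem.

-- The ultrapower of N, cut down to the countable set of functions ℕ → N obtained from the
-- sequence a by Skolem functions.  Only countably many sets of indices have to be measured, so
-- that an ultrafilter on ℕ, and with it an extensional choice principle, is not needed.
module SkolemUltrapower (em : ∀ {a} → ExcludedMiddle a) {ℓ} (N : Structure ℓ)
                        (a : ℕ → Structure.Carrier N) where

  private module N = Structure N

  Element : Set ℓ
  Element = Skolem

  mutual
    value : Element → ℕ → N.Carrier
    value generic   i = a i
    value (add s t) i = value s i N.+ value t i
    value (mul s t) i = value s i N.* value t i
    value (wit β)   i with em {P = ∃ (holds β i)}
    ... | yes (x , _) = x
    ... | no  _       = a i

    values : ∀ {n} → Vec Element n → ℕ → Vec N.Carrier n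
    values []       i = []
    values (t ∷ ts) i = value t i ∷ values ts i

    holds : BooleanCombination (Literal Element) → ℕ → Pred N.Carrier ℓ
    holds (atom (n , φ , ts)) i x = Sat N φ (x ∷ values ts i)
    holds (not β)             i x = ¬ holds β i x
    holds (β and γ)           i x = holds β i x × holds γ i x
    holds (β or γ)            i x = holds β i x ⊎ holds γ i x

  -- `holds` repeats the clauses of `combine` so that its mutual recursion with `value` stays
  -- structural; this identifies the two.
  combine-holds : ∀ β i → combine (λ l → holds (atom l) i) β ≡ holds β i
  combine-holds (atom _)  i = refl
  combine-holds (not β)   i = cong ∁ (combine-holds β i)
  combine-holds (β and γ) i = cong₂ _∩_ (combine-holds β i) (combine-holds γ i)
  combine-holds (β or γ)  i = cong₂ _∪_ (combine-holds β i) (combine-holds γ i)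

  value-wit : ∀ {β i x} → holds β i x → holds β i (value (wit β) i)
  value-wit {β} {i} βx with em {P = ∃ (holds β i)}
  ... | yes (_ , βy) = βy
  ... | no  ¬β       = ⊥-elim (¬β (_ , βx))

  Condition : Set ℓ
  Condition = WithParameters Formula Element

  ⟦_⟧ : Condition → Pred ℕ ℓ
  ⟦ n , φ , ts ⟧ i = Sat N φ (values ts i)

  open Refinement em ⟦_⟧ (λ k → withParameters formulas k (skolems k))
    (λ (n , φ , ts) → eventually-⊆
      (λ (n<k , φ∈ , ts∈) → ∈-withParameters⁺ formulas n<k φ∈ ts∈)
      (eventually-∩ (eventually-> n)
        (eventually-∩ (formulas-exhaustive φ) (vecs-exhaustive ts))))
    public using (Large; large-⊆; large-∩; large-infinite; large-disjoint; large-decided)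

  private module ≈ = IsEquivalence N.isEquivalence

  ultrapower : Structure ℓ
  ultrapower = record
    { Carrier       = Element
    ; _≈_           = λ s t → Large (λ i → value s i N.≈ value t i)
    ; _+_           = add
    ; _*_           = mul
    ; _∣_           = λ s t → Large (λ i → value s i N.∣ value t i)
    ; isEquivalence = record
      { refl  = 0 , λ _ → ≈.refl
      ; sym   = large-⊆ ≈.sym
      ; trans = λ p q → large-⊆ (λ (x≈y , y≈z) → ≈.trans x≈y y≈z) (large-∩ p q)
      }
    ; +-cong        = λ p q → large-⊆ (λ (x , y) → N.+-cong x y) (large-∩ p q)
    ; *-cong        = λ p q → large-⊆ (λ (x , y) → N.*-cong x y) (large-∩ p q)
    ; ∣-resp-≈      = (λ p q → large-⊆ (λ (x , y) → proj₁ N.∣-resp-≈ x y) (large-∩ p q))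
                    , (λ p q → large-⊆ (λ (x , y) → proj₂ N.∣-resp-≈ x y) (large-∩ p q))
    }

  value-lookup : ∀ {n} (ts : Vec Element n) j i → lookup (values ts i) j ≡ value (lookup ts j) i
  value-lookup (t ∷ ts) zero    i = refl
  value-lookup (t ∷ ts) (suc j) i = value-lookup ts j i

  value-eval : ∀ {n} (t : Term n) ts i → eval N t (values ts i) ≡ value (eval ultrapower t ts) i
  value-eval (var j)  ts i = value-lookup ts j i
  value-eval (s +′ t) ts i = cong₂ N._+_ (value-eval s ts i) (value-eval t ts i)
  value-eval (s *′ t) ts i = cong₂ N._*_ (value-eval s ts i) (value-eval t ts i)

  -- Negation works because every condition or its complement is large, and the quantifier because
  -- the Skolem term `wit β` is a solution at every index that has one.
  łoś : ∀ {n} (φ : Formula n) ts → Sat ultrapower φ ts ⇔ Large ⟦ n , φ , ts ⟧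
  łoś (s ≈′ t) ts = mk⇔
    (large-⊆ λ {i} → subst₂ N._≈_ (sym (value-eval s ts i)) (sym (value-eval t ts i)))
    (large-⊆ λ {i} → subst₂ N._≈_ (value-eval s ts i) (value-eval t ts i))
  łoś (s ∣′ t) ts = mk⇔
    (large-⊆ λ {i} → subst₂ N._∣_ (sym (value-eval s ts i)) (sym (value-eval t ts i)))
    (large-⊆ λ {i} → subst₂ N._∣_ (value-eval s ts i) (value-eval t ts i))
  łoś (¬′ φ) ts = mk⇔
    (λ ¬φ → [ (λ L → ⊥-elim (¬φ (from (łoś φ ts) L))) , id ]′ (large-decided (_ , φ , ts)))
    (λ L φ⊨ → large-disjoint (to (łoś φ ts) φ⊨) L)
  łoś (φ ∧′ ψ) ts = mk⇔
    (λ (φ⊨ , ψ⊨) → large-∩ (to (łoś φ ts) φ⊨) (to (łoś ψ ts) ψ⊨))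
    (λ L → from (łoś φ ts) (large-⊆ proj₁ L) , from (łoś ψ ts) (large-⊆ proj₂ L))
  łoś (∃′ φ) ts = mk⇔
    (λ (t , φ⊨) → large-⊆ (λ φt → _ , φt) (to (łoś φ (t ∷ ts)) φ⊨))
    (λ L → wit β , from (łoś φ (wit β ∷ ts)) (large-⊆ (λ (x , φx) → value-wit {β} φx) L))
    where β = atom (_ , φ , ts)

  ultrapower-⊨ : ultrapower ⊨ Th N
  ultrapower-⊨ σ N⊨σ = from (łoś σ []) (0 , λ _ → N⊨σ)

  literalSet : Literal Element → Pred Element ℓ
  literalSet (n , φ , ts) t = Sat ultrapower φ (t ∷ ts)

  -- Łoś's theorem for boolean combinations, put as a dichotomy so that negation merely swaps the
  -- two alternatives.
  holds-decided : ∀ β t → Large (λ i → holds β i (value t i)) × combine literalSet β t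
                        ⊎ Large (λ i → ¬ holds β i (value t i)) × ¬ combine literalSet β t
  holds-decided (atom (n , φ , ts)) t with large-decided (_ , φ , t ∷ ts)
  ... | inj₁ L = inj₁ (L , from (łoś φ (t ∷ ts)) L)
  ... | inj₂ L = inj₂ (L , λ φ⊨ → large-disjoint (to (łoś φ (t ∷ ts)) φ⊨) L)
  holds-decided (not β) t with holds-decided β t
  ... | inj₁ (L , βt)  = inj₂ (large-⊆ (λ p ¬p → ¬p p) L , λ ¬βt → ¬βt βt)
  ... | inj₂ (L , ¬βt) = inj₁ (L , ¬βt)
  holds-decided (β and γ) t with holds-decided β t | holds-decided γ t
  ... | inj₁ (L , βt)  | inj₁ (L′ , γt)  = inj₁ (large-∩ L L′ , βt , γt)
  ... | inj₂ (L , ¬βt) | _               = inj₂ (large-⊆ (_∘ proj₁) L , ¬βt ∘ proj₁)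
  ... | _              | inj₂ (L , ¬γt)  = inj₂ (large-⊆ (_∘ proj₂) L , ¬γt ∘ proj₂)
  holds-decided (β or γ) t with holds-decided β t | holds-decided γ t
  ... | inj₂ (L , ¬βt) | inj₂ (L′ , ¬γt) =
    inj₂ (large-⊆ (λ (¬p , ¬q) → [ ¬p , ¬q ]′) (large-∩ L L′) , [ ¬βt , ¬γt ]′)
  ... | inj₁ (L , βt)  | _               = inj₁ (large-⊆ inj₁ L , inj₁ βt)
  ... | _              | inj₁ (L , γt)   = inj₁ (large-⊆ inj₂ L , inj₂ γt)

  -- The compactness step. If `β` failed at `wit β`, it would fail on a large set of indices; this
  -- set is unbounded, so it contains an index past `k`, where `wit β` takes a solution as its
  -- value.
  combine-wit : ∀ β k → (∀ i → k ℕ.≤ i → ∃ (holds β i)) → combine literalSet β (wit β)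
  combine-wit β k sat with holds-decided β (wit β)
  ... | inj₁ (_ , βt) = βt
  ... | inj₂ (L , _)  = case large-infinite L k of λ where
    (i , k≤i , ¬βi) → ⊥-elim (¬βi (value-wit {β} (proj₂ (sat i k≤i))))

-- Counting changes in sequences of truth values.

change : Bool → Bool → ℕ
change b c = if does (b Bool.≟ c) then 0 else 1

changes : List Bool → ℕ
changes []           = 0
changes (b ∷ [])     = 0
changes (b ∷ c ∷ bs) = change b c ℕ.+ changes (c ∷ bs)

alternating : Bool → ℕ → List Bool
alternating b zero    = []
alternating b (suc n) = b ∷ alternating (Bool.not b) n

changes-alternating : ∀ b n → changes (alternating b (suc n)) ≡ n
changes-alternating b     zero    = refl
changes-alternating false (suc n) = cong suc (changes-alternating true n)
changes-alternating true  (suc n) = cong suc (changes-alternating false n)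

-- The result of an operation can change only where one of its arguments does.
change-op : ∀ (_∙_ : Bool → Bool → Bool) b b′ c c′ →
            change (b ∙ b′) (c ∙ c′) ℕ.≤ change b c ℕ.+ change b′ c′
change-op _∙_ b b′ c c′ with b Bool.≟ c | b′ Bool.≟ c′ | (b ∙ b′) Bool.≟ (c ∙ c′)
... | _        | _        | yes _ = z≤n
... | no _     | _        | no _  = s≤s z≤n
... | yes _    | no _     | no _  = ℕ.≤-refl
... | yes refl | yes refl | no ≢  = ⊥-elim (≢ refl)

change≤1 : ∀ b c → change b c ℕ.≤ 1
change≤1 b c with b Bool.≟ c
... | yes _ = z≤n
... | no _  = ℕ.≤-refl

module _ {x} {X : Set x} where

  changes-pointwise : ∀ (_∙_ : Bool → Bool → Bool) (f g : X → Bool) xs →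
                      changes (map (λ x → f x ∙ g x) xs) ℕ.≤ changes (map f xs) ℕ.+ changes (map g xs)
  changes-pointwise _∙_ f g []           = z≤n
  changes-pointwise _∙_ f g (x ∷ [])     = z≤n
  changes-pointwise _∙_ f g (x ∷ y ∷ xs) = ℕ.≤-trans
    (ℕ.+-mono-≤ (change-op _∙_ (f x) (g x) (f y) (g y)) (changes-pointwise _∙_ f g (y ∷ xs)))
    (ℕ.≤-reflexive (interchange ℕ.+-commutativeSemigroup (change (f x) (f y)) (change (g x) (g y)) _ _))

  changes-op : ∀ (_∙_ : Bool → Bool → Bool) {f g h : X → Bool} → (∀ x → h x ≡ f x ∙ g x) →
               ∀ xs {m n} → changes (map f xs) ℕ.≤ m → changes (map g xs) ℕ.≤ n →
               changes (map h xs) ℕ.≤ m ℕ.+ n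
  changes-op _∙_ {f} {g} h≗f∙g xs f≤m g≤n = ℕ.≤-trans
    (ℕ.≤-reflexive (cong changes (map-cong h≗f∙g xs)))
    (ℕ.≤-trans (changes-pointwise _∙_ f g xs) (ℕ.+-mono-≤ f≤m g≤n))

  changes-const : ∀ {f : X → Bool} {b} {xs} → All (λ x → f x ≡ b) xs → changes (map f xs) ≡ 0
  changes-const []       = refl
  changes-const (_ ∷ []) = refl
  changes-const {f} {b} {x ∷ y ∷ xs} (p ∷ q ∷ ps) =
    trans (cong (ℕ._+ changes (map f (y ∷ xs))) (trans (cong₂ change p q) (change-refl b)))
      (changes-const (q ∷ ps))
    where
    change-refl : ∀ b → change b b ≡ 0
    change-refl false = refl
    change-refl true  = refl

  module _ {r} {_≼_ : X → X → Set r} (f : X → Bool)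
           (convex : ∀ {x y z} → x ≼ y → y ≼ z → f x ≡ true → f z ≡ true → f y ≡ true) where

    -- A convex set containing `x` cannot be re-entered once it has been left, so the only possible
    -- change is the exit.
    changes-after-true : ∀ {x xs} → AllPairs _≼_ (x ∷ xs) → f x ≡ true → changes (map f (x ∷ xs)) ℕ.≤ 1
    changes-after-true {x} {[]} _ fx = z≤n
    changes-after-true {x} {y ∷ ys} ((x≼y ∷ _) ∷ (y≼ys ∷ ps)) fx with f y Bool.≟ true
    ... | yes fy = ℕ.≤-trans
      (ℕ.≤-reflexive (cong (ℕ._+ changes (map f (y ∷ ys))) (cong₂ change fx fy)))
      (changes-after-true (y≼ys ∷ ps) fy)
    ... | no fy≢true = ℕ.≤-reflexive
      (cong₂ ℕ._+_ (cong₂ change fx (Bool.¬-not fy≢true))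
        (changes-const (Bool.¬-not fy≢true
          ∷ All.map (λ y≼z → Bool.¬-not (λ fz → fy≢true (convex x≼y y≼z fx fz))) y≼ys)))

    -- One change for entering the set and one for leaving it.
    changes-convex : ∀ {xs} → AllPairs _≼_ xs → changes (map f xs) ℕ.≤ 2
    changes-convex {[]}         _        = z≤n
    changes-convex {x ∷ []}     _        = z≤n
    changes-convex {x ∷ y ∷ ys} (p ∷ ps) with f x Bool.≟ true | f y Bool.≟ true
    ... | yes fx    | _         = ℕ.≤-trans (changes-after-true (p ∷ ps) fx) (s≤s z≤n)
    ... | no _      | yes fy    = ℕ.+-mono-≤ (change≤1 (f x) (f y)) (changes-after-true ps fy)
    ... | no fx≢    | no fy≢    = ℕ.≤-trans
      (ℕ.≤-reflexive (cong (ℕ._+ changes (map f (y ∷ ys)))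
        (cong₂ change (Bool.¬-not fx≢) (Bool.¬-not fy≢))))
      (changes-convex ps)

-- The balls and the parameter-free formulas in a combination.

module _ {a c} {A : Set a} {C : Set c} where

  balls : BooleanCombination (A ⊎ C) → List A
  balls (atom (inj₁ j)) = j ∷ []
  balls (atom (inj₂ θ)) = []
  balls (not β)         = balls β
  balls (β and γ)       = balls β ++ balls γ
  balls (β or γ)        = balls β ++ balls γ

  thetas : BooleanCombination (A ⊎ C) → List C
  thetas (atom (inj₁ j)) = []
  thetas (atom (inj₂ θ)) = θ ∷ []
  thetas (not β)         = thetas β
  thetas (β and γ)       = thetas β ++ thetas γ
  thetas (β or γ)        = thetas β ++ thetas γ

  length-balls-++ : ∀ β γ → length (balls β ++ balls γ) ℕ.* 2
                            ≡ length (balls β) ℕ.* 2 ℕ.+ length (balls γ) ℕ.* 2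
  length-balls-++ β γ =
    trans (cong (ℕ._* 2) (length-++ (balls β))) (ℕ.*-distribʳ-+ 2 (length (balls β)) (length (balls γ)))

module _ {a b c} {A : Set a} {B : Set b} {C : Set c} (f : A → B) where

  -- Together with `thetas-mapBC` this shows that passing from the ultrapower to a factor preserves
  -- the complexity of a combination.
  balls-mapBC : (β : BooleanCombination (A ⊎ C)) → balls (mapBC (Sum.map₁ f) β) ≡ map f (balls β)
  balls-mapBC (atom (inj₁ _)) = refl
  balls-mapBC (atom (inj₂ _)) = refl
  balls-mapBC (not β)         = balls-mapBC β
  balls-mapBC (β and γ)       =
    trans (cong₂ _++_ (balls-mapBC β) (balls-mapBC γ)) (sym (map-++ f (balls β) (balls γ)))
  balls-mapBC (β or γ)        =
    trans (cong₂ _++_ (balls-mapBC β) (balls-mapBC γ)) (sym (map-++ f (balls β) (balls γ)))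

  thetas-mapBC : (β : BooleanCombination (A ⊎ C)) → thetas (mapBC (Sum.map₁ f) β) ≡ thetas β
  thetas-mapBC (atom (inj₁ _)) = refl
  thetas-mapBC (atom (inj₂ _)) = refl
  thetas-mapBC (not β)         = thetas-mapBC β
  thetas-mapBC (β and γ)       = cong₂ _++_ (thetas-mapBC β) (thetas-mapBC γ)
  thetas-mapBC (β or γ)        = cong₂ _++_ (thetas-mapBC β) (thetas-mapBC γ)

-- Labelled trees and the Ramsey argument.

-- Binary trees whose inner nodes carry labels from w, the same ones along all branches: leaves that
-- part at a node labelled b are in the relation E b.
module _ {x} {X : Set x} (E : Bool → X → X → Set) where

  mutual
    data Tree : List Bool → Set x where
      leaf : X → Tree []
      node : ∀ {b w} (l r : Tree w) →
             (∀ {x y} → x ∈ leaves l → y ∈ leaves r → E b x y × E b y x) → Tree (b ∷ w)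

    leaves : ∀ {w} → Tree w → List X
    leaves (leaf x)     = x ∷ []
    leaves (node l r _) = leaves l ++ leaves r

module _ {x} {X : Set x} {E : Bool → X → X → Set} where

  Coloured : (X → Bool) → Bool → ∀ {v w} → Tree E v → Tree E w → Set x
  Coloured f b t s = leaves E s ⊆ᴸ leaves E t × (∀ {x} → x ∈ leaves E s → f x ≡ b)

  -- Either both halves contain a tree of the first colour, to be joined at the root, or one of
  -- them already contains a tree of the second colour.
  ramsey : ∀ w {u} (f : X → Bool) (t : Tree E (w ++ u)) →
           ∃ (Coloured f true {w = w} t) ⊎ ∃ (Coloured f false {w = u} t)
  ramsey [] f t with any? (λ x → f x Bool.≟ true) (leaves E t)
  ... | yes p = case find p of λ where
    (x , x∈ , fx) → inj₁ (leaf x , (λ { (here refl) → x∈ }) , (λ { (here refl) → fx }))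
  ... | no ¬p = inj₂ (t , id , λ x∈ → Bool.¬-not (λ fx → ¬p (lose x∈ fx)))
  ramsey (b ∷ w) f (node l r e) with ramsey w f l | ramsey w f r
  ... | inj₂ (s , s⊆l , mono) | _ = inj₂ (s , ∈-++⁺ˡ ∘ s⊆l , mono)
  ... | _ | inj₂ (s , s⊆r , mono) = inj₂ (s , ∈-++⁺ʳ (leaves E l) ∘ s⊆r , mono)
  ... | inj₁ (l′ , l′⊆l , monoˡ) | inj₁ (r′ , r′⊆r , monoʳ) =
    inj₁ ( node l′ r′ (λ x∈ y∈ → e (l′⊆l x∈) (r′⊆r y∈))
         , [ ∈-++⁺ˡ ∘ l′⊆l , ∈-++⁺ʳ (leaves E l) ∘ r′⊆r ]′ ∘ ∈-++⁻ (leaves E l′)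
         , [ monoˡ , monoʳ ]′ ∘ ∈-++⁻ (leaves E l′) )

  -- `ramsey` divides its word between the two colours. With both parts equal to `repeat cs w`, the
  -- same shape is left whichever colour wins, so each formula doubles the word.
  repeat : ∀ {c} {C : Set c} → List C → List Bool → List Bool
  repeat []       w = w
  repeat (_ ∷ cs) w = repeat cs w ++ repeat cs w

  homogeneous : ∀ {c} {C : Set c} (f : C → X → Bool) cs {w} (t : Tree E (repeat cs w)) →
                Σ (Tree E w) λ s → leaves E s ⊆ᴸ leaves E t ×
                  (∀ {c} → c ∈ cs → ∃[ b ] ∀ {x} → x ∈ leaves E s → f c x ≡ b)
  homogeneous f []       t = t , id , λ ()
  homogeneous f (c ∷ cs) {w} t with subtree (ramsey (repeat cs w) (f c) t)
    where
    subtree : ∃ (Coloured (f c) true {w = repeat cs w} t) ⊎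
              ∃ (Coloured (f c) false {w = repeat cs w} t) →
              ∃[ b ] ∃ (Coloured (f c) b {w = repeat cs w} t)
    subtree (inj₁ s) = true , s
    subtree (inj₂ s) = false , s
  ... | b , s , s⊆t , mono with homogeneous f cs s
  ...   | s′ , s′⊆s , mono′ = s′ , s⊆t ∘ s′⊆s , λ where
    (here refl) → b , mono ∘ s′⊆s
    (there c∈)  → mono′ c∈

-- The balls are bounded only in number, as infinitely many formulas may define them; the
-- parameter-free formulas come from a finite list, as the Ramsey argument requires.
NotCombination : ∀ {x c ℓ} {X : Set x} {J : Set x} {C : Set c} → (J → Pred X ℓ) → (C → Pred X ℓ) →
                 ℕ → List C → Pred X ℓ → Set _
NotCombination B Θ k cs P =
  ∀ β → length (balls β) ℕ.≤ k → All (_∈ cs) (thetas β) → ¬ (P ≐ combine [ B , Θ ]′ β)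

-- The lexicographic order and combs in trees.

boolListOrder : DecTotalOrder _ _ _
boolListOrder = Lex.≤-decTotalOrder Bool.≤-decTotalOrder

open DecTotalOrder boolListOrder using () renaming (_≤_ to _≤ᴷ_)

lex-head : ∀ {b c bs cs} → b ∷ bs ≤ᴷ c ∷ cs → b ≡ true → c ≡ true
lex-head (Lex.this (Bool.b≤b , _)) eq = eq
lex-head (Lex.next refl _)         eq = eq

-- The middle head is squeezed between two equal ones, so both comparisons pass to the tails.
lex-tails : ∀ {b c d bs cs ds} → b ≡ d → b ∷ bs ≤ᴷ c ∷ cs → c ∷ cs ≤ᴷ d ∷ ds → bs ≤ᴷ cs × cs ≤ᴷ ds
lex-tails refl (Lex.next _ p)             (Lex.next _ q)             = p , q
lex-tails refl (Lex.this (Bool.b≤b , ≢))  _                          = ⊥-elim (≢ refl)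
lex-tails refl _                          (Lex.this (Bool.b≤b , ≢))  = ⊥-elim (≢ refl)
lex-tails refl (Lex.this (Bool.f≤t , _))  (Lex.next () _)
lex-tails refl (Lex.next () _)            (Lex.this (Bool.f≤t , _))

module _ {x} {X : Set x} {E : Bool → X → X → Set} (key : X → List Bool) where

  minimum : ∀ {w} (t : Tree E w) →
            ∃[ m ] m ∈ leaves E t × (∀ {x} → x ∈ leaves E t → key m ≤ᴷ key x)
  minimum t = m , argmin-all totalOrder key {P = _∈ leaves E t} (first∈ t) (All.tabulate id)
            , All.lookup (f[argmin]≤f[xs] totalOrder {f = key} (first t) (leaves E t))
    where
    open DecTotalOrder boolListOrder using (totalOrder)

    first : ∀ {w} → Tree E w → X
    first (leaf x)     = x
    first (node l _ _) = first l

    first∈ : ∀ {w} (t : Tree E w) → first t ∈ leaves E t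
    first∈ (leaf x)     = here refl
    first∈ (node l _ _) = ∈-++⁺ˡ (first∈ l)

    m = argmin totalOrder key (first t) (leaves E t)

  -- The least leaf comes first, and the comb goes on in the half that does not contain it.
  comb : ∀ {w} (t : Tree E w) → ∃[ a ] ∃[ xs ]
         a ∈ leaves E t × All (_∈ leaves E t) xs ×
         AllPairs (λ x y → key x ≤ᴷ key y) xs ×
         Pointwise (λ b x → E b x a) w xs
  comb (leaf x) = x , [] , here refl , [] , [] , []
  comb {b ∷ w} t@(node l r e) = side (∈-++⁻ (leaves E l) m∈)
    where
    least = minimum t
    m    = proj₁ least
    m∈   = proj₁ (proj₂ least)
    m≤   = proj₂ (proj₂ least)

    -- The least leaf may lie in either half, while the edge always runs from `m` to the later `a`;
    -- hence nodes carry the relation in both directions.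
    side : m ∈ leaves E l ⊎ m ∈ leaves E r → _
    side (inj₁ m∈l) = case comb r of λ where
      (a , xs , a∈r , xs∈r , sort , edges) →
        let xs∈ = All.map (∈-++⁺ʳ (leaves E l)) xs∈r in
        a , m ∷ xs , ∈-++⁺ʳ (leaves E l) a∈r , m∈ ∷ xs∈
        , All.map m≤ xs∈ ∷ sort , proj₁ (e m∈l a∈r) ∷ edges
    side (inj₂ m∈r) = case comb l of λ where
      (a , xs , a∈l , xs∈l , sort , edges) →
        let xs∈ = All.map ∈-++⁺ˡ xs∈l in
        a , m ∷ xs , ∈-++⁺ˡ a∈l , m∈ ∷ xs∈
        , All.map m≤ xs∈ ∷ sort , proj₂ (e a∈l m∈r) ∷ edges

-- Truth values, and the changes of a combination.

module _ (em : ∀ {a} → ExcludedMiddle a) where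

  bit : ∀ {p} → Set p → Bool
  bit P = does (em {P = P})

  bit-true : ∀ {p} {P : Set p} → P → bit P ≡ true
  bit-true = dec-true em

  bit-⇔ : ∀ {p q} {P : Set p} {Q : Set q} → P ⇔ Q → bit P ≡ bit Q
  bit-⇔ P⇔Q = does-⇔ P⇔Q em em

  true-bit : ∀ {p} {P : Set p} → bit P ≡ true → P
  true-bit {P = P} eq with em {P = P}
  ... | yes p = p

  bit-¬ : ∀ {p} (P : Set p) → bit (¬ P) ≡ Bool.not (bit P)
  bit-¬ P = does-⇔ (mk⇔ id id) em (¬? em)

  bit-× : ∀ {p} (P Q : Set p) → bit (P × Q) ≡ bit P ∧ bit Q
  bit-× P Q = does-⇔ (mk⇔ id id) em (em ×-dec em)

  bit-⊎ : ∀ {p} (P Q : Set p) → bit (P ⊎ Q) ≡ bit P ∨ bit Q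
  bit-⊎ P Q = does-⇔ (mk⇔ id id) em (em ⊎-dec em)

  module _ {x ℓ j c} {X : Set x} {J : Set j} {C : Set c} (B : J → Pred X ℓ) (Θ : C → Pred X ℓ) where

    changes-combine : ∀ xs β →
                      (∀ {j} → j ∈ balls β → changes (map (bit ∘ B j) xs) ℕ.≤ 2) →
                      (∀ {θ} → θ ∈ thetas β → changes (map (bit ∘ Θ θ) xs) ≡ 0) →
                      changes (map (bit ∘ combine [ B , Θ ]′ β) xs) ℕ.≤ length (balls β) ℕ.* 2
    changes-combine xs (atom (inj₁ j)) few none = few (here refl)
    changes-combine xs (atom (inj₂ θ)) few none = ℕ.≤-reflexive (none (here refl))
    changes-combine xs (not β) few none = ℕ.≤-trans
      -- Negation is treated as a binary operation whose second argument is constant and so adds no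
      -- change.
      (changes-op (λ b _ → Bool.not b) {bit ∘ combine [ B , Θ ]′ β} {λ _ → true}
        (λ x → bit-¬ (combine [ B , Θ ]′ β x)) xs
        (changes-combine xs β few none)
        (ℕ.≤-reflexive (changes-const (All.universal (λ _ → refl) xs))))
      (ℕ.≤-reflexive (ℕ.+-identityʳ _))
    changes-combine xs (β and γ) few none = ℕ.≤-trans
      (changes-op _∧_ {bit ∘ combine [ B , Θ ]′ β} {bit ∘ combine [ B , Θ ]′ γ}
        (λ x → bit-× (combine [ B , Θ ]′ β x) (combine [ B , Θ ]′ γ x)) xs
        (changes-combine xs β (few ∘ ∈-++⁺ˡ) (none ∘ ∈-++⁺ˡ))
        (changes-combine xs γ (few ∘ ∈-++⁺ʳ (balls β)) (none ∘ ∈-++⁺ʳ (thetas β))))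
      (ℕ.≤-reflexive (sym (length-balls-++ β γ)))
    changes-combine xs (β or γ) few none = ℕ.≤-trans
      (changes-op _∨_ {bit ∘ combine [ B , Θ ]′ β} {bit ∘ combine [ B , Θ ]′ γ}
        (λ x → bit-⊎ (combine [ B , Θ ]′ β x) (combine [ B , Θ ]′ γ x)) xs
        (changes-combine xs β (few ∘ ∈-++⁺ˡ) (none ∘ ∈-++⁺ˡ))
        (changes-combine xs γ (few ∘ ∈-++⁺ʳ (balls β)) (none ∘ ∈-++⁺ʳ (thetas β))))
      (ℕ.≤-reflexive (sym (length-balls-++ β γ)))

  -- Sorting balls to make them convex.

  module _ {x} {X J : Set x} (B : J → Pred X x) (directed : DirectedFamily B) where

    -- In a list sorted by Below, two points of a ball agree on all the balls listed before it; this
    -- makes every ball convex for the lexicographic order of the membership vectors.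
    Below : J → J → Set x
    Below i j = B j ⊆ B i ⊎ B j ⊥ B i

    insert : J → List J → List J
    insert j [] = j ∷ []
    insert j (i ∷ is) with em {P = Below i j}
    ... | yes _ = i ∷ insert j is
    ... | no  _ = j ∷ i ∷ is

    insert-⊇ : ∀ j is {k} → k ∈ j ∷ is → k ∈ insert j is
    insert-⊇ j [] k∈ = k∈
    insert-⊇ j (i ∷ is) k∈ with em {P = Below i j}
    ... | no _ = k∈
    insert-⊇ j (i ∷ is) (here refl)         | yes _ = there (insert-⊇ j is (here refl))
    insert-⊇ j (i ∷ is) (there (here refl)) | yes _ = here refl
    insert-⊇ j (i ∷ is) (there (there k∈))  | yes _ = there (insert-⊇ j is (there k∈))

    insert-All : ∀ {p} {P : Pred J p} {j is} → P j → All P is → All P (insert j is)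
    insert-All pj [] = pj ∷ []
    insert-All {j = j} {i ∷ is} pj (pi ∷ ps) with em {P = Below i j}
    ... | yes _ = pi ∷ insert-All pj ps
    ... | no  _ = pj ∷ pi ∷ ps

    -- By directedness `¬ Below i j` forces `B i ⊆ B j`. A set inside `B i` is then inside `B j`; a
    -- set disjoint from `B i` cannot contain `B j`, since `B j` meets `B i`, so it is inside `B j`
    -- or disjoint from it.
    below-later : ∀ {i j k} → ¬ Below i j → Below i k → Below j k
    below-later {i} {j} {k} ¬ij ik with directed i j
    ... | inj₂ (inj₁ j⊆i)  = ⊥-elim (¬ij (inj₁ j⊆i))
    ... | inj₂ (inj₂ i⊥j)  = ⊥-elim (¬ij (inj₂ (λ (x∈j , x∈i) → i⊥j (x∈i , x∈j))))
    ... | inj₁ i⊆j with ik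
    ...   | inj₁ k⊆i = inj₁ (i⊆j ∘ k⊆i)
    ...   | inj₂ k⊥i with directed k j
    ...     | inj₁ k⊆j        = inj₁ k⊆j
    ...     | inj₂ (inj₁ j⊆k) = ⊥-elim (¬ij (inj₂ (λ (x∈j , x∈i) → k⊥i (j⊆k x∈j , x∈i))))
    ...     | inj₂ (inj₂ k⊥j) = inj₂ k⊥j

    insert-sorted : ∀ j {is} → AllPairs Below is → AllPairs Below (insert j is)
    insert-sorted j [] = [] ∷ []
    insert-sorted j {i ∷ is} (p ∷ ps) with em {P = Below i j}
    ... | yes ij = insert-All ij p ∷ insert-sorted j ps
    ... | no ¬ij = (below-later ¬ij (inj₁ id) ∷ All.map (below-later ¬ij) p) ∷ p ∷ ps

    sorted : ∀ js → ∃[ is ] AllPairs Below is × (∀ {j} → j ∈ js → j ∈ is)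
    sorted [] = [] , [] , λ ()
    sorted (j ∷ js) with sorted js
    ... | is , sort , js⊆is = insert j is , insert-sorted j sort , λ where
      (here refl) → insert-⊇ j is (here refl)
      (there k∈)  → insert-⊇ j is (there (js⊆is k∈))

    key : List J → X → List Bool
    key js x = map (λ j → bit (B j x)) js

    bit-agree : ∀ {i j x z} → Below i j → B j x → B j z → bit (B i x) ≡ bit (B i z)
    bit-agree (inj₁ j⊆i) jx jz = bit-⇔ (mk⇔ (λ _ → j⊆i jz) (λ _ → j⊆i jx))
    bit-agree (inj₂ j⊥i) jx jz =
      bit-⇔ (mk⇔ (λ ix → ⊥-elim (j⊥i (jx , ix))) (λ iz → ⊥-elim (j⊥i (jz , iz))))

    -- As `x` and `z` agree on all balls listed before `j`, so does `y` between them. At `j` itself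
    -- `true` is the greater bit, so `x ∈ B j` carries over to `y`.
    key-convex : ∀ {js} → AllPairs Below js → ∀ {j} → j ∈ js → ∀ {x y z} →
                 key js x ≤ᴷ key js y → key js y ≤ᴷ key js z →
                 bit (B j x) ≡ true → bit (B j z) ≡ true → bit (B j y) ≡ true
    key-convex (_ ∷ _) (here refl) x≤y _ jx _ = lex-head x≤y jx
    key-convex {i ∷ js} (p ∷ ps) {j} (there j∈) {x} {y} {z} x≤y y≤z jx jz =
      key-convex ps j∈ (proj₁ tails) (proj₂ tails) jx jz
      where
      tails = lex-tails (bit-agree (All.lookup p j∈) (true-bit jx) (true-bit jz)) x≤y y≤z

  -- No bound on the combinations serves all the sets `P a`.

  module _ {x c} {X J : Set x} {C : Set c} (B : J → Pred X x) (directed : DirectedFamily B)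
           (Θ : C → Pred X x) (P : X → Pred X x)
           (tree : ∀ w → Tree (λ b x y → bit (P y x) ≡ b) w) where

    unbounded-combinations : ∀ k cs → ∃ (NotCombination B Θ k cs ∘ P)
    unbounded-combinations k cs with em {P = ∃ (NotCombination B Θ k cs ∘ P)}
    ... | yes p = p
    ... | no ¬p = ⊥-elim (ℕ.1+n≰n (ℕ.≤-trans (ℕ.≤-reflexive (sym changes-P)) changes-β))
      where
      bounded : ∀ a → ∃[ β ] length (balls β) ℕ.≤ k × All (_∈ cs) (thetas β) ×
                             P a ≐ combine [ B , Θ ]′ β
      bounded a = decidable-stable em λ ¬β →
        ¬p (a , λ β few cs∋ eq → ¬β (β , few , cs∋ , eq))

      β   = λ a → proj₁ (bounded a)
      few = λ a → proj₁ (proj₂ (bounded a))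
      cs∋ = λ a → proj₁ (proj₂ (proj₂ (bounded a)))
      P≐β = λ a → proj₂ (proj₂ (proj₂ (bounded a)))

      -- One change more than `k` convex balls allow; a word with `n` changes has `suc n` letters.
      n = suc (k ℕ.* 2)
      w = alternating true (suc n)

      homogeneous-tree = homogeneous (λ θ → bit ∘ Θ θ) cs
        (tree (repeat {E = λ b x y → bit (P y x) ≡ b} cs w))
      t    = proj₁ homogeneous-tree
      mono = proj₂ (proj₂ homogeneous-tree)

      -- The point `a` depends on the order, so the order has to serve the balls of `β y` for every
      -- leaf `y` at once.
      sorted-balls = sorted B directed (concatMap (balls ∘ β) (leaves _ t))
      js   = proj₁ sorted-balls
      sort = proj₁ (proj₂ sorted-balls)
      js⊇  = proj₂ (proj₂ sorted-balls)

      a-comb = comb (key B directed js) t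
      a     = proj₁ a-comb
      xs    = proj₁ (proj₂ a-comb)
      a∈    = proj₁ (proj₂ (proj₂ a-comb))
      xs∈   = proj₁ (proj₂ (proj₂ (proj₂ a-comb)))
      chain = proj₁ (proj₂ (proj₂ (proj₂ (proj₂ a-comb))))
      edges = proj₂ (proj₂ (proj₂ (proj₂ (proj₂ a-comb))))

      labels : ∀ {w xs} → Pointwise (λ b x → bit (P a x) ≡ b) w xs → map (bit ∘ P a) xs ≡ w
      labels []       = refl
      labels (e ∷ es) = cong₂ _∷_ e (labels es)

      changes-P : changes (map (bit ∘ P a) xs) ≡ n
      changes-P = trans (cong changes (labels edges)) (changes-alternating true n)

      changes-β : changes (map (bit ∘ P a) xs) ℕ.≤ k ℕ.* 2
      changes-β = ℕ.≤-trans
        (ℕ.≤-reflexive (cong changes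
          (map-cong (λ _ → bit-⇔ (mk⇔ (proj₁ (P≐β a)) (proj₂ (P≐β a)))) xs)))
        (ℕ.≤-trans
          (changes-combine B Θ xs (β a)
            (λ {j} j∈ → changes-convex (bit ∘ B j)
              (key-convex B directed sort (js⊇ (∈-concatMap⁺ (balls ∘ β) (lose a∈ j∈)))) chain)
            (λ θ∈ → changes-const (All.map (proj₂ (mono (All.lookup (cs∋ a) θ∈))) xs∈)))
          (ℕ.*-monoˡ-≤ 2 (few a)))

-- Divisibility in ordered abelian groups.

module OrderedGroup {ℓ} (Γ : OrderedAbelianGroup ℓ) where

  open OrderedAbelianGroup Γ public
    renaming (refl to ≈-refl; sym to ≈-sym; trans to ≈-trans)
  open Mult commutativeMonoid public
    using (×-congʳ; ×-assocˡ; ×-distrib-+) renaming (_×_ to _·_)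
  open GroupProperties group public using (\\-leftDividesʳ; ⁻¹-involutive; //-rightDividesʳ)
  open IsTotalOrder isTotalOrder public
    using (≤-respˡ-≈; ≤-respʳ-≈; antisym)
    renaming (refl to ≤-refl; trans to ≤-trans; total to ≤-total)
  open SetoidReasoning setoid

  infix 4 _DivisibleBy_

  _DivisibleBy_ : Carrier → ℕ → Set ℓ
  γ DivisibleBy n = ∃[ δ ] n · δ ≈ γ

  divisible-resp-≈ : ∀ n {γ γ′} → γ ≈ γ′ → γ DivisibleBy n → γ′ DivisibleBy n
  divisible-resp-≈ _ γ≈γ′ (δ , nδ≈γ) = δ , ≈-trans nδ≈γ γ≈γ′

  ·-zeroʳ : ∀ n → n · 0# ≈ 0#
  ·-zeroʳ zero    = ≈-refl
  ·-zeroʳ (suc n) = ≈-trans (identityˡ _) (·-zeroʳ n)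

  divisible-0 : ∀ n → 0# DivisibleBy n
  divisible-0 n = 0# , ·-zeroʳ n

  divisible-neg : ∀ n {γ} → γ DivisibleBy n → (- γ) DivisibleBy n
  divisible-neg n {γ} (δ , nδ≈γ) = - δ , (begin
    n · (- δ)                      ≈⟨ \\-leftDividesʳ (n · δ) (n · (- δ)) ⟨
    - (n · δ) + (n · δ + n · (- δ)) ≈⟨ ∙-congˡ (×-distrib-+ δ (- δ) n) ⟨
    - (n · δ) + n · (δ + - δ)       ≈⟨ ∙-congˡ (×-congʳ n (inverseʳ δ)) ⟩
    - (n · δ) + n · 0#              ≈⟨ ∙-congˡ (·-zeroʳ n) ⟩
    - (n · δ) + 0#                  ≈⟨ identityʳ _ ⟩
    - (n · δ)                       ≈⟨ ⁻¹-cong nδ≈γ ⟩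
    - γ                             ∎)

  divisible-+ : ∀ n {γ γ′} → γ DivisibleBy n → γ′ DivisibleBy n → (γ + γ′) DivisibleBy n
  divisible-+ n (δ , nδ≈γ) (δ′ , nδ′≈γ′) =
    δ + δ′ , ≈-trans (×-distrib-+ δ δ′ n) (∙-cong nδ≈γ nδ′≈γ′)

  -- For `γ` outside `nΓ`, the multiple `(n * m) · γ` lies in `nΓ` and the next one does not; for
  -- positive `n` both exponents are at least `m`, so patterns can be prescribed arbitrarily far
  -- out.
  exponent : ℕ → Bool → ℕ → ℕ
  exponent n true  m = n ℕ.* m
  exponent n false m = suc (n ℕ.* m)

  exponent-≥ : ∀ n b m → m ℕ.≤ exponent (suc n) b m
  exponent-≥ n true  m = ℕ.m≤m+n m (n ℕ.* m)
  exponent-≥ n false m = ℕ.m≤n⇒m≤1+n (ℕ.m≤m+n m (n ℕ.* m))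

  divisible-* : ∀ n m γ → ((n ℕ.* m) · γ) DivisibleBy n
  divisible-* n m γ = m · γ , ×-assocˡ γ n m

  exponent-divisible : ∀ {n γ} → ¬ (γ DivisibleBy n) →
                       ∀ b m → (exponent n b m · γ) DivisibleBy n ⇔ b ≡ true
  exponent-divisible {n} {γ} ¬div true  m = mk⇔ (λ _ → refl) (λ _ → divisible-* n m γ)
  exponent-divisible {n} {γ} ¬div false m = mk⇔
    (λ div → ⊥-elim (¬div (divisible-resp-≈ n (//-rightDividesʳ (n·m·γ) γ)
      (divisible-+ n div (divisible-neg n (divisible-* n m γ))))))
    (λ ())
    where n·m·γ = (n ℕ.* m) · γ

  module _ {γ} (0≤γ : 0# ≤ γ) where

    ·-monoˡ-≤ : ∀ {m n} → m ℕ.≤ n → m · γ ≤ n · γ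
    ·-monoˡ-≤ m≤n = go (ℕ.≤⇒≤′ m≤n)
      where
      go : ∀ {m n} → m ℕ.≤′ n → m · γ ≤ n · γ
      go (ℕ.≤′-reflexive refl) = ≤-refl
      go (ℕ.≤′-step {n} m≤′n)  = ≤-trans (go m≤′n)
        (≤-respˡ-≈ (identityʳ (n · γ)) (≤-respʳ-≈ (comm (n · γ) γ) (+-monoʳ-≤ (n · γ) 0≤γ)))

    -- Serves as strict monotonicity of multiples: a `γ` outside `nΓ` is not zero.
    ·-cancel-suc : ∀ {m} → suc m · γ ≤ m · γ → γ ≈ 0#
    ·-cancel-suc {m} γ+mγ≤mγ = antisym
      (≤-respˡ-≈ (≈-trans (∙-congˡ (comm γ (m · γ))) (\\-leftDividesʳ (m · γ) γ))
        (≤-respʳ-≈ (inverseˡ (m · γ)) (+-monoʳ-≤ (- (m · γ)) γ+mγ≤mγ)))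
      0≤γ

-- The ultrametric, the sets `S_a` and the trees in a valued field.

module ValuedField {ℓ} {K : Field ℓ} {Γ : OrderedAbelianGroup ℓ} (V : Valuation K Γ) where

  private
    module K where
      open Field K public hiding (ring)
      open RingProperties (CommutativeRing.ring commutativeRing) public using (-1*x≈-x)
      open GroupProperties (Ring.+-group (CommutativeRing.ring commutativeRing)) public
    module Γ = OrderedGroup Γ

  open Valuation V
  open Extended Γ
  open TotalOrder totalOrder⁺ using ()
    renaming (≤-respˡ-≈ to ≤⁺-respˡ-≈; ≤-respʳ-≈ to ≤⁺-respʳ-≈; antisym to ≤⁺-antisym;
              refl to ≤⁺-refl; reflexive to ≤⁺-reflexive; trans to ≤⁺-trans; total to ≤⁺-total;
              module Eq to ≈⁺)
  open Min totalOrder⁺ using (⊓-glb)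

  -- The ultrametric with the order reversed: large values mean small distances.
  distance : K.Carrier → K.Carrier → Γ.Carrier ⁺
  distance x y = v (x K.- y)

  +⁺-monoʳ-≤ : ∀ γ {δ ε} → δ ≤⁺ ε → γ +⁺ δ ≤⁺ γ +⁺ ε
  +⁺-monoʳ-≤ [ γ ] SupOrder.[ δ≤ε ]     = SupOrder.[ Γ.+-monoʳ-≤ γ δ≤ε ]
  +⁺-monoʳ-≤ [ γ ] (δ SupOrder.≤⊤⁺)     = _ SupOrder.≤⊤⁺
  +⁺-monoʳ-≤ ⊤⁺    _                    = ⊤⁺ SupOrder.≤⊤⁺

  -- There is no need to compute `v (- 1)`: adding it to both sides of `v x ≤ v (- x)` yields
  -- `v (- x) ≤ v x`.
  v-neg-≤ : ∀ x → v (K.- x) ≤⁺ v x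
  v-neg-≤ x with ≤⁺-total (v (K.- x)) (v x)
  ... | inj₁ p = p
  ... | inj₂ p = ≤⁺-respˡ-≈ (≈⁺.sym (v-minus x)) (≤⁺-respʳ-≈
      (≈⁺.trans (≈⁺.sym (v-minus (K.- x))) (v-cong (K.⁻¹-involutive x)))
      (+⁺-monoʳ-≤ (v (K.- K.1#)) p))
    where
    v-minus : ∀ x → v (K.- x) ≈⁺ v (K.- K.1#) +⁺ v x
    v-minus x = ≈⁺.trans (v-cong (K.sym (K.-1*x≈-x x))) (v-* (K.- K.1#) x)

  distance-sym-≤ : ∀ x y → distance x y ≤⁺ distance y x
  distance-sym-≤ x y = ≤⁺-respˡ-≈ (v-cong (K.⁻¹-anti-homo-// y x)) (v-neg-≤ (y K.- x))

  distance-sym : ∀ x y → distance x y ≈⁺ distance y x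
  distance-sym x y = ≤⁺-antisym (distance-sym-≤ x y) (distance-sym-≤ y x)

  distance-triangle : ∀ {γ} x y z → γ ≤⁺ distance x y → γ ≤⁺ distance y z → γ ≤⁺ distance x z
  distance-triangle x y z γ≤xy γ≤yz =
    ≤⁺-trans (⊓-glb γ≤xy γ≤yz) (≤⁺-respʳ-≈ (v-cong telescope) (v-+ (x K.- y) (y K.- z)))
    where
    telescope : (x K.- y) K.+ (y K.- z) K.≈ x K.- z
    telescope = K.trans (K.sym (K.+-assoc (x K.- y) y (K.- z))) (K.+-congʳ (K.//-rightDividesˡ y x))

  -- The negated inequality says that `y` and `z` are strictly closer than `x` and `y`, so replacing
  -- `y` by `z` does not affect the distance from `x`.
  distance-isosceles : ∀ {γ} x y z → distance x y ≈⁺ γ → ¬ (distance y z ≤⁺ γ) → distance x z ≈⁺ γ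
  distance-isosceles {γ} x y z xy≈γ yz≰γ = ≤⁺-antisym xz≤γ
    (distance-triangle x y z (≤⁺-reflexive (≈⁺.sym xy≈γ))
      ([ id , (λ yz≤γ → ⊥-elim (yz≰γ yz≤γ)) ]′ (≤⁺-total γ (distance y z))))
    where
    xz≤γ : distance x z ≤⁺ γ
    xz≤γ with ≤⁺-total (distance x z) (distance z y)
    ... | inj₁ xz≤zy = ≤⁺-respʳ-≈ xy≈γ (distance-triangle x z y ≤⁺-refl xz≤zy)
    ... | inj₂ zy≤xz = ⊥-elim (yz≰γ (≤⁺-trans (distance-sym-≤ y z)
                         (≤⁺-respʳ-≈ xy≈γ (distance-triangle x z y zy≤xz ≤⁺-refl))))

  structure : Structure ℓ
  structure = valuedFieldStructure V

  infixr 8 _^suc_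

  -- The language has no constant 1, so only positive powers are terms.
  _^suc_ : ∀ {k} → Term k → ℕ → Term k
  t ^suc zero  = t
  t ^suc suc n = t *′ (t ^suc n)

  -- v(x − a) ∈ (n + 1)Γ ∪ {∞}, where x is index zero and a is index one.
  distanceDivisible : ℕ → Formula 2
  distanceDivisible n =
    ∃′ (var zero +′ var (suc (suc zero)) ≈′ var (suc zero)
        ∧′ ∃′ ((var zero ^suc n ∣′ var (suc zero)) ∧′ (var (suc zero) ∣′ var zero ^suc n)))

  -- Applied to positive `n` only, for which `∞` is the correct multiple of `∞`.
  _·⁺_ : ℕ → Γ.Carrier ⁺ → Γ.Carrier ⁺
  n ·⁺ [ γ ] = [ n Γ.· γ ]
  n ·⁺ ⊤⁺    = ⊤⁺

  v-^suc : ∀ {k} (t : Term k) ρ n →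
           v (eval structure (t ^suc n) ρ) ≈⁺ suc n ·⁺ v (eval structure t ρ)
  v-^suc t ρ zero with v (eval structure t ρ)
  ... | [ γ ] = SupEquality.[ Γ.≈-sym (Γ.identityʳ γ) ]
  ... | ⊤⁺    = SupEquality.⊤⁺≈⊤⁺
  v-^suc t ρ (suc n) = ≈⁺.trans (v-* y yⁿ) (step (v-^suc t ρ n))
    where
    y  = eval structure t ρ
    yⁿ = eval structure (t ^suc n) ρ

    step : v yⁿ ≈⁺ suc n ·⁺ v y → v y +⁺ v yⁿ ≈⁺ suc (suc n) ·⁺ v y
    step eq with v y | v yⁿ | eq
    ... | [ γ ] | _ | SupEquality.[ p ] = SupEquality.[ Γ.∙-congˡ p ]
    ... | ⊤⁺    | _ | _                 = SupEquality.⊤⁺≈⊤⁺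

  distanceDivisible-⇔ : ∀ n x a {γ} → distance x a ≈⁺ [ γ ] →
    definedSet structure (distanceDivisible n) (a ∷ []) x ⇔ γ Γ.DivisibleBy suc n
  distanceDivisible-⇔ n x a {γ} xa≈γ = mk⇔ only-if if
    where
    only-if : definedSet structure (distanceDivisible n) (a ∷ []) x → γ Γ.DivisibleBy suc n
    only-if (z , z+a≈x , y , yⁿ≤z , z≤yⁿ) = root
      (≈⁺.trans (≈⁺.sym (v-^suc (var zero) (y ∷ z ∷ x ∷ a ∷ []) n))
        (≈⁺.trans (≤⁺-antisym yⁿ≤z z≤yⁿ)
          (≈⁺.trans (v-cong (K.x≈z//y z a x z+a≈x)) xa≈γ)))
      where
      root : suc n ·⁺ v y ≈⁺ [ γ ] → γ Γ.DivisibleBy suc n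
      root eq with v y | eq
      ... | [ δ ] | SupEquality.[ p ] = δ , p

    if : γ Γ.DivisibleBy suc n → definedSet structure (distanceDivisible n) (a ∷ []) x
    if (δ , nδ≈γ) with surjective δ
    ... | y , vy≈δ = z , K.//-rightDividesˡ a x , y , ≤⁺-reflexive yⁿ≈z , ≤⁺-reflexive (≈⁺.sym yⁿ≈z)
      where
      z = x K.- a

      power : v y ≈⁺ [ δ ] → suc n ·⁺ v y ≈⁺ [ γ ]
      power eq with v y | eq
      ... | [ _ ] | SupEquality.[ p ] = SupEquality.[ Γ.≈-trans (Γ.×-congʳ (suc n) p) nδ≈γ ]

      yⁿ≈z = ≈⁺.trans (v-^suc (var zero) (y ∷ z ∷ x ∷ a ∷ []) n)
               (≈⁺.trans (power vy≈δ) (≈⁺.sym xa≈γ))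

  module _ (em : ∀ {a} → ExcludedMiddle a) {n γ} (0≤γ : Γ.0# Γ.≤ γ)
           (¬div : ¬ (γ Γ.DivisibleBy suc n)) where

    Label : Bool → K.Carrier → K.Carrier → Set
    Label b x y = bit em (definedSet structure (distanceDivisible n) (y ∷ []) x) ≡ b

    label : ∀ b m {x y} → distance x y ≈⁺ [ Γ.exponent (suc n) b m Γ.· γ ] → Label b x y
    label b m {x} {y} xy≈ = trans
      (bit-⇔ em (mk⇔ (to (Γ.exponent-divisible ¬div b m) ∘ to (distanceDivisible-⇔ n x y xy≈))
                     (from (distanceDivisible-⇔ n x y xy≈) ∘ from (Γ.exponent-divisible ¬div b m))))
      (bit-≡true b)
      where
      bit-≡true : ∀ b → bit em (b ≡ true) ≡ b
      bit-≡true true  = bit-true em refl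
      bit-≡true false = does-≡ em (no (λ ()))

    -- A point `q` with `v (q − p)` exactly `e · γ` is chosen, where `e ≥ m` has the kind prescribed
    -- by `b`. One half clusters around `p` and the other around `q`, both with value at least
    -- `suc e · γ`, so points of different halves differ by value exactly `e · γ`. The lower bound
    -- at `p` keeps this induction going.
    labelledTree : ∀ w m p → Σ (Tree Label w) λ t →
                   All (λ x → [ m Γ.· γ ] ≤⁺ distance x p) (leaves Label t)
    labelledTree [] m p = leaf p
      , ≤⁺-respʳ-≈ (≈⁺.sym (from (v≈∞⇔x≈0 (p K.- p)) (K.-‿inverseʳ p))) (_ SupOrder.≤⊤⁺) ∷ []
    labelledTree (b ∷ w) m p =
        node (proj₁ left) (proj₁ right)
          (λ x∈ y∈ → split (All.lookup (proj₂ left) x∈) (All.lookup (proj₂ right) y∈))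
      , All.++⁺
          (All.map (≤⁺-trans (≤-· m≤1+e)) (proj₂ left))
          (All.map (λ {y} e<yq → distance-triangle y q p (≤⁺-trans (≤-· m≤1+e) e<yq)
            (≤⁺-respʳ-≈ (≈⁺.sym qp≈e) (≤-· m≤e))) (proj₂ right))
      where
      e   = Γ.exponent (suc n) b m
      m≤e = Γ.exponent-≥ n b m
      m≤1+e = ℕ.m≤n⇒m≤1+n m≤e
      c   = proj₁ (surjective (e Γ.· γ))
      q   = c K.+ p

      qp≈e : distance q p ≈⁺ [ e Γ.· γ ]
      qp≈e = ≈⁺.trans (v-cong (K.//-rightDividesʳ p c)) (proj₂ (surjective (e Γ.· γ)))

      left  = labelledTree w (suc e) p
      right = labelledTree w (suc e) q

      ≤-· : ∀ {i j} → i ℕ.≤ j → [ i Γ.· γ ] ≤⁺ [ j Γ.· γ ]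
      ≤-· i≤j = SupOrder.[ Γ.·-monoˡ-≤ 0≤γ i≤j ]

      far : ∀ {δ} → [ suc e Γ.· γ ] ≤⁺ δ → ¬ (δ ≤⁺ [ e Γ.· γ ])
      far e<δ δ≤e = ¬div (Γ.divisible-resp-≈ (suc n) (Γ.≈-sym γ≈0) (Γ.divisible-0 (suc n)))
        where γ≈0 = Γ.·-cancel-suc 0≤γ {e} (SupOrder.[≤]-injective _ (≤⁺-trans e<δ δ≤e))

      split : ∀ {x y} → [ suc e Γ.· γ ] ≤⁺ distance x p → [ suc e Γ.· γ ] ≤⁺ distance y q →
              Label b x y × Label b y x
      split {x} {y} e<xp e<yq = label b m xy≈e , label b m (≈⁺.trans (distance-sym y x) xy≈e)
        where
        qx≈e : distance q x ≈⁺ [ e Γ.· γ ]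
        qx≈e = distance-isosceles q p x qp≈e (far (≤⁺-trans e<xp (distance-sym-≤ x p)))

        xy≈e : distance x y ≈⁺ [ e Γ.· γ ]
        xy≈e = distance-isosceles x q y (≈⁺.trans (distance-sym x q) qx≈e)
                 (far (≤⁺-trans e<yq (distance-sym-≤ y q)))

-- Compactness: a set in the ultrapower that is no combination.

ballsAndFormulas : ∀ {ℓ} (Ψ : FormulaSet ℓ) (M : Structure ℓ) →
                   Instance Ψ M ⊎ Formula 1 → Pred (Structure.Carrier M) ℓ
ballsAndFormulas Ψ M = [ instanceSet Ψ M , (λ θ → definedSet M θ []) ]′

module _ (em : ∀ {a} → ExcludedMiddle a) {ℓ} (N : Structure ℓ) (Ψ : FormulaSet ℓ)
         (φ : Formula 2) (a : ℕ → Structure.Carrier N)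
         (complex : ∀ i → NotCombination (instanceSet Ψ N) (λ θ → definedSet N θ [])
                            i (formulas 1 i) (definedSet N φ (a i ∷ []))) where

  open SkolemUltrapower em N a
  open FormulaSet Ψ

  literal : Instance Ψ ultrapower ⊎ Formula 1 → Literal Element
  literal (inj₁ (j , ts)) = arity j , ψ j , ts
  literal (inj₂ θ)        = 0 , θ , []

  component : ℕ → Instance Ψ ultrapower → Instance Ψ N
  component i (j , ts) = j , values ts i

  thetas-listed : (θs : List (Formula 1)) → Eventually (λ k → All (_∈ formulas 1 k) θs)
  thetas-listed []       = 0 , λ _ → []
  thetas-listed (θ ∷ θs) =
    eventually-⊆ (λ (p , ps) → p ∷ ps) (eventually-∩ (formulas-exhaustive θ) (thetas-listed θs))

  module _ (β : BooleanCombination (Instance Ψ ultrapower ⊎ Formula 1)) where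

    β̂ : BooleanCombination (Literal Element)
    β̂ = mapBC literal β

    φ̂ : BooleanCombination (Literal Element)
    φ̂ = atom (1 , φ , generic ∷ [])

    -- The symmetric difference; `wit difference` will separate `φ` from `β` in the ultrapower.
    difference : BooleanCombination (Literal Element)
    difference = (φ̂ and not β̂) or (not φ̂ and β̂)

    combine-β̂ : ∀ {t} → combine (ballsAndFormulas Ψ ultrapower) β t ⇔ combine literalSet β̂ t
    combine-β̂ = combine-mapBC literal (λ { (inj₁ _) → mk⇔ id id ; (inj₂ _) → mk⇔ id id }) β

    holds-component : ∀ i {x} →
      holds β̂ i x ⇔ combine (ballsAndFormulas Ψ N) (mapBC (Sum.map₁ (component i)) β) x
    holds-component i {x} = mk⇔
      (λ h → to (combine-mapBC _ agree β) (from (combine-mapBC literal (λ _ → mk⇔ id id) β)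
               (subst (λ P → P x) (sym (combine-holds β̂ i)) h)))
      (λ h → subst (λ P → P x) (combine-holds β̂ i)
               (to (combine-mapBC literal (λ _ → mk⇔ id id) β) (from (combine-mapBC _ agree β) h)))
      where
      agree : ∀ l {x} → holds (atom (literal l)) i x ⇔
                        ballsAndFormulas Ψ N (Sum.map₁ (component i) l) x
      agree (inj₁ _) = mk⇔ id id
      agree (inj₂ _) = mk⇔ id id

    -- Once `i` bounds the number of balls and `formulas 1 i` lists the parameter-free formulas of
    -- `β`, the component of `β` at `i` is among the combinations that `complex i` excludes.
    eventually-difference : Eventually (λ i → ∃ (holds difference i))
    eventually-difference = eventually-⊆ different
      (eventually-∩ (length (balls β) , id) (thetas-listed (thetas β)))
      where
      different : ∀ {i} → length (balls β) ℕ.≤ i × All (_∈ formulas 1 i) (thetas β) →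
                  ∃ (holds difference i)
      different {i} (few , listed) = decidable-stable em λ same →
        complex i (mapBC (Sum.map₁ (component i)) β)
          (subst (ℕ._≤ i) (sym (trans (cong length (balls-mapBC (component i) β))
                                      (length-map (component i) (balls β)))) few)
          (subst (All (_∈ formulas 1 i)) (sym (thetas-mapBC (component i) β)) listed)
          ( (λ φx → to (holds-component i)
               (decidable-stable em λ ¬βx → same (_ , inj₁ (φx , ¬βx))))
          , (λ βx → decidable-stable em λ ¬φx → same (_ , inj₂ (¬φx , from (holds-component i) βx))) )

    not-equivalent : ¬ (definedSet ultrapower φ (generic ∷ []) ≐
                        combine (ballsAndFormulas Ψ ultrapower) β)
    not-equivalent (φ⊆β , β⊆φ) with eventually-difference
    ... | k , different with combine-wit difference k (λ i k≤i → different k≤i)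
    ...   | inj₁ (φt , ¬βt) = ¬βt (to combine-β̂ (φ⊆β φt))
    ...   | inj₂ (¬φt , βt) = ¬φt (β⊆φ (from combine-β̂ βt))

-- Divisibility of the value group.

theorem4p6 : (∀ {a} → ExcludedMiddle a) →
    ∀ {ℓ} (K : Field ℓ) (Γ : OrderedAbelianGroup ℓ) (V : Valuation K Γ) →
    QuasiVCMinimal (Th (valuedFieldStructure V)) →
    Divisible Γ
theorem4p6 em K Γ V (Ψ , directed , definable) (suc n) γ =
  decidable-stable em λ ¬div → case ≤-total 0# γ of λ where
    (inj₁ 0≤γ) → impossible 0≤γ ¬div
    -- For `γ ≤ 0` the argument is applied to `- γ`, which is nonnegative and likewise not
    -- divisible.
    (inj₂ γ≤0) → impossible
      (≤-respˡ-≈ (inverseˡ γ) (≤-respʳ-≈ (identityʳ (- γ)) (+-monoʳ-≤ (- γ) γ≤0)))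
      (¬div ∘ divisible-resp-≈ (suc n) (⁻¹-involutive γ) ∘ divisible-neg (suc n))
  where
  open OrderedGroup Γ
  open ValuedField V

  impossible : ∀ {γ} → 0# ≤ γ → ¬ ¬ (γ DivisibleBy suc n)
  impossible 0≤γ ¬div = not-equivalent em structure Ψ φ a (proj₂ ∘ complex)
    (proj₁ combination) (proj₂ combination)
    where
    φ = distanceDivisible n

    complex = λ i → unbounded-combinations em (instanceSet Ψ structure)
      (directed structure (λ _ → id)) (λ θ → definedSet structure θ [])
      (λ x → definedSet structure φ (x ∷ []))
      (λ w → proj₁ (labelledTree em {n} 0≤γ ¬div w 0 (Field.0# K))) i (formulas 1 i)

    a = proj₁ ∘ complex

    open SkolemUltrapower em structure a using (ultrapower; ultrapower-⊨)

    -- `generic` represents the sequence `a`. Directedness was applied in `K`, definability is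
    -- applied in the ultrapower.
    combination = definable ultrapower ultrapower-⊨ φ (generic ∷ [])
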